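{- For every 3-uniform hypergraph $H$ with $R_2(H)\geq \max\{|V(H)|+1,7\}$, we have $f(H,\mathcal{L})=R_2(H)$.
   Context: For a 3-graph $H$, $R_2(H)$ is the minimum $n$ such that every 2-edge-coloring of $K^{(3)}_n$ contains a monochromatic copy of $H$. The constrained Ramsey number $f(H,G)$ is the minimum $n$ such that every edge-coloring of $K^{(3)}_n$ with any number of colors contains either a monochromatic copy of $H$ or a rainbow copy of $G$. The loose path $\mathcal{L}$ is the 3-graph with vertices $v_1,\ldots,v_7$ and edges $\{v_1v_2v_3,v_3v_4v_5,v_5v_6v_7\}$. -}

module Defs where

open import Data.Nat using (ℕ; _<_)
open import Data.Bool using (Bool)
open import Data.Fin using (Fin; zero; suc)
open import Data.Fin.Subset using (Subset; ⁅_⁆; _∪_)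
open import Data.Product using (_×_; _,_; Σ)
open import Data.Sum using (_⊎_)
open import Function.Definitions using (Injective)
open import Relation.Binary.PropositionalEquality using (_≡_; _≢_)
open import Relation.Nullary using (¬_)

Triple : ℕ → Set
Triple k = Fin k × Fin k × Fin k

toSet : ∀ {k} → Triple k → Subset k
toSet (a , b , c) = ⁅ a ⁆ ∪ ⁅ b ⁆ ∪ ⁅ c ⁆

mapTriple : ∀ {k n} → (Fin k → Fin n) → Triple k → Triple n
mapTriple φ (a , b , c) = (φ a , φ b , φ c)

record Hyp3 : Set where
  field
    k        : ℕ
    m        : ℕ
    edge     : Fin m → Triple k
    distinct : ∀ i → let (a , b , c) = edge i in a ≢ b × b ≢ c × a ≢ c
    simple   : ∀ i j → toSet (edge i) ≡ toSet (edge j) → i ≡ j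
open Hyp3 public

-- An edge-colouring of the complete 3-graph K_n^(3) with colour set C:
-- a colour for every 3-element subset of Fin n (values on other subsets are
-- irrelevant, since only images of edges under injective maps are inspected).
Colouring : ℕ → Set → Set
Colouring n C = Subset n → C

colourOf : ∀ {n C} (H : Hyp3) → Colouring n C → (Fin (k H) → Fin n) → Fin (m H) → C
colourOf H χ φ i = χ (toSet (mapTriple φ (edge H i)))

HasMono : ∀ {n C} (H : Hyp3) → Colouring n C → Set
HasMono {n} H χ = Σ (Fin (k H) → Fin n) λ φ → Injective _≡_ _≡_ φ ×
  (∀ i j → colourOf H χ φ i ≡ colourOf H χ φ j)

HasRainbow : ∀ {n C} (G : Hyp3) → Colouring n C → Set
HasRainbow {n} G χ = Σ (Fin (k G) → Fin n) λ φ → Injective _≡_ _≡_ φ ×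
  (∀ i j → colourOf G χ φ i ≡ colourOf G χ φ j → i ≡ j)

Arrows2 : Hyp3 → ℕ → Set
Arrows2 H n = (χ : Colouring n Bool) → HasMono H χ

-- Every edge-colouring of K_n^(3) with any number of colours (colours taken
-- from ℕ, which suffices as K_n^(3) has finitely many edges) has a
-- monochromatic H or a rainbow G.
ArrowsCR : Hyp3 → Hyp3 → ℕ → Set
ArrowsCR H G n = (χ : Colouring n ℕ) → HasMono H χ ⊎ HasRainbow G χ

IsMin : (ℕ → Set) → ℕ → Set
IsMin P r = P r × (∀ n → n < r → ¬ P n)

IsR2 : Hyp3 → ℕ → Set
IsR2 H r = IsMin (Arrows2 H) r

IsConstrainedRamsey : Hyp3 → Hyp3 → ℕ → Set
IsConstrainedRamsey H G r = IsMin (ArrowsCR H G) r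

private
  v : ℕ → Fin 7
  v 0 = zero
  v 1 = suc zero
  v 2 = suc (suc zero)
  v 3 = suc (suc (suc zero))
  v 4 = suc (suc (suc (suc zero)))
  v 5 = suc (suc (suc (suc (suc zero))))
  v _ = suc (suc (suc (suc (suc (suc zero)))))

  Ledge : Fin 3 → Triple 7
  Ledge zero = (v 0 , v 1 , v 2)
  Ledge (suc zero) = (v 2 , v 3 , v 4)
  Ledge (suc (suc zero)) = (v 4 , v 5 , v 6)

  Ldistinct : ∀ i → let (a , b , c) = Ledge i in a ≢ b × b ≢ c × a ≢ c
  Ldistinct zero = (λ ()) , (λ ()) , (λ ())
  Ldistinct (suc zero) = (λ ()) , (λ ()) , (λ ())
  Ldistinct (suc (suc zero)) = (λ ()) , (λ ()) , (λ ())

  Lsimple : ∀ i j → toSet (Ledge i) ≡ toSet (Ledge j) → i ≡ j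
  Lsimple zero zero _ = _≡_.refl
  Lsimple zero (suc zero) ()
  Lsimple zero (suc (suc zero)) ()
  Lsimple (suc zero) zero ()
  Lsimple (suc zero) (suc zero) _ = _≡_.refl
  Lsimple (suc zero) (suc (suc zero)) ()
  Lsimple (suc (suc zero)) zero ()
  Lsimple (suc (suc zero)) (suc zero) ()
  Lsimple (suc (suc zero)) (suc (suc zero)) _ = _≡_.refl

LoosePath : Hyp3
LoosePath = record
  { k = 7 ; m = 3 ; edge = Ledge ; distinct = Ldistinct ; simple = Lsimple }

{-# OPTIONS --safe #-}
-- A 2-colouring has no rainbow loose path, so only the upper bound needs an argument: a rainbow-free
-- colouring χ of K_n, n ≥ 7, with at least three colours must contain a monochromatic H.
--
-- Take two edges xyz and xyw of different colours A ≠ B and an edge of a third colour.  After possibly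
-- exchanging the roles of the three colours, an edge stu disjoint from Q = {x,y,z,w} has a colour C
-- different from A and B.  Rainbow-freeness then forces colour C on every edge meeting Q in at most one
-- vertex, and leaves so little freedom for the others that either some vertex lies on all edges of
-- colour ≠ C, or some triple T meets all of them twice.  In the first case deleting the vertex leaves
-- a monochromatic K_{n-1}, which contains H.  In the second, apply the hypothesis on H to the 2-colouring
-- "C or not C": a copy of H avoiding C is moved into colour C by a permutation carrying T off itself.
module Submission where

open import Defs
open import Data.Nat using (ℕ; _≥_; suc; _⊔_; _<_; _≤_)
import Data.Nat.Properties as ℕ
open import Data.Bool using (Bool; true; false)
import Data.Bool.Properties as Bool
open import Data.Fin using (Fin; zero; suc; _≟_; inject≤; punchIn)
open import Data.Fin.Patterns
open import Data.Fin.Properties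
  using (all?; any?; injective⇒≤; punchIn-injective; punchInᵢ≢i; inject≤-injective)
open import Data.Fin.Subset using (Subset; inside; outside; ⁅_⁆; _∪_; ⊥; _∈_)
open import Data.Fin.Subset.Properties
  using (∪-assoc; ∪-comm; ∪-idem; ∪-identityʳ; ∪-idempotentCommutativeMonoid;
         x∈⁅x⁆; x∈⁅y⁆⇒x≡y; x∈p∪q⁻; x∈p∪q⁺)
import Algebra.Solver.IdempotentCommutativeMonoid as Solver
open import Data.List using (List)
import Data.List.Relation.Unary.Any as Any
open import Data.Vec using (Vec; []; _∷_; lookup; map; tabulate; toList)
open import Data.Vec.Properties using (lookup-map; lookup∘tabulate; ≡-dec)
open import Data.Product using (Σ; ∃; _×_; _,_; proj₁; proj₂)
open import Data.Sum as Sum using (_⊎_; inj₁; inj₂; swap; [_,_]′)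
open import Function using (_∘_)
open import Function.Definitions using (Injective)
open import Relation.Binary.PropositionalEquality
open import Relation.Nullary using
  (¬_; Dec; yes; no; does; contradiction; map′; _→-dec_; _×-dec_; ¬?)
open import Relation.Nullary.Decidable using (True; toWitness; from-yes; dec-true)

-- Pulling colourings back along injections

Distinct : ∀ {n m} → Vec (Fin n) m → Set
Distinct v = ∀ i j → lookup v i ≡ lookup v j → i ≡ j

distinct? : ∀ {n m} (v : Vec (Fin n) m) → Dec (Distinct v)
distinct? v = all? λ i → all? λ j → (lookup v i ≟ lookup v j) →-dec (i ≟ j)

select : ∀ {n m k} → Vec (Fin n) m → Vec (Fin m) k → Vec (Fin n) k
select v ψ = map (lookup v) ψ

select-distinct : ∀ {n m k} (v : Vec (Fin n) m) (ψ : Vec (Fin m) k) →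
  Distinct v → Distinct ψ → Distinct (select v ψ)
select-distinct v ψ dv dψ i j eq = dψ i j (dv _ _
  (trans (sym (lookup-map i (lookup v) ψ)) (trans eq (lookup-map j (lookup v) ψ))))

-- By recursion on the membership vector, so that the image of a concrete subset of `Fin 7` unfolds
-- by computation.
image : ∀ {m n} → (Fin m → Fin n) → Subset m → Subset n
image f []            = ⊥
image f (inside ∷ p)  = ⁅ f zero ⁆ ∪ image (f ∘ suc) p
image f (outside ∷ p) = image (f ∘ suc) p

image-⊥ : ∀ {m n} (f : Fin m → Fin n) → image f ⊥ ≡ ⊥
image-⊥ {ℕ.zero} f = refl
image-⊥ {ℕ.suc m} f = image-⊥ (f ∘ suc)

image-⁅⁆ : ∀ {m n} (f : Fin m → Fin n) i → image f ⁅ i ⁆ ≡ ⁅ f i ⁆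
image-⁅⁆ f zero = trans (cong (⁅ f zero ⁆ ∪_) (image-⊥ (f ∘ suc))) (∪-identityʳ _)
image-⁅⁆ f (suc i) = image-⁅⁆ (f ∘ suc) i

image-∪ : ∀ {m n} (f : Fin m → Fin n) p q → image f (p ∪ q) ≡ image f p ∪ image f q
image-∪ f [] [] = sym (∪-idem ⊥)
image-∪ f (outside ∷ p) (outside ∷ q) = image-∪ (f ∘ suc) p q
image-∪ f (inside ∷ p) (outside ∷ q) =
  trans (cong (⁅ f zero ⁆ ∪_) (image-∪ (f ∘ suc) p q)) (sym (∪-assoc _ _ _))
image-∪ f (outside ∷ p) (inside ∷ q) =
  trans (cong (⁅ f zero ⁆ ∪_) (image-∪ (f ∘ suc) p q))
    (solve 3 (λ a b c → a ⊕ (b ⊕ c) ⊜ b ⊕ (a ⊕ c)) refl _ _ _)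
  where open Solver (∪-idempotentCommutativeMonoid _)
image-∪ f (inside ∷ p) (inside ∷ q) =
  trans (cong (⁅ f zero ⁆ ∪_) (image-∪ (f ∘ suc) p q))
    (solve 3 (λ a b c → a ⊕ (b ⊕ c) ⊜ (a ⊕ b) ⊕ (a ⊕ c)) refl _ _ _)
  where open Solver (∪-idempotentCommutativeMonoid _)

image-toSet : ∀ {m n} (f : Fin m → Fin n) τ → image f (toSet τ) ≡ toSet (mapTriple f τ)
image-toSet f (a , b , c) = trans (image-∪ f ⁅ a ⁆ (⁅ b ⁆ ∪ ⁅ c ⁆))
  (cong₂ _∪_ (image-⁅⁆ f a) (trans (image-∪ f ⁅ b ⁆ ⁅ c ⁆) (cong₂ _∪_ (image-⁅⁆ f b) (image-⁅⁆ f c))))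

RainbowFree : ∀ {n} → Colouring n ℕ → Set
RainbowFree χ = ¬ HasRainbow LoosePath χ

-- The point of pulling back to Fin 7: toSet of a concrete triple normalises, so the colour of an edge
-- is independent of the order of its vertices definitionally.
infixl 9 _⟨_⟩

_⟨_⟩ : ∀ {m n} → Colouring n ℕ → Vec (Fin n) m → Colouring m ℕ
χ ⟨ v ⟩ = χ ∘ image (lookup v)

⟨⟩-toSet : ∀ {m n} (χ : Colouring n ℕ) (v : Vec (Fin n) m) τ →
  (χ ⟨ v ⟩) (toSet τ) ≡ χ (toSet (mapTriple (lookup v) τ))
⟨⟩-toSet χ v τ = cong χ (image-toSet (lookup v) τ)

⟨⟩-rainbowFree : ∀ {m n} (χ : Colouring n ℕ) (v : Vec (Fin n) m) → Distinct v →
  RainbowFree χ → RainbowFree (χ ⟨ v ⟩)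
⟨⟩-rainbowFree χ v dv free (φ , φ-inj , rainbow) =
  free (lookup v ∘ φ , φ-inj ∘ dv _ _ , λ i j eq → rainbow i j
    (trans (⟨⟩-toSet χ v _) (trans eq (sym (⟨⟩-toSet χ v _)))))

-- Forced colours on seven vertices

-- The standard forcing step: one loose path confines the colour of an edge to {A, K}, a second one
-- to {B, K}, and only K is common to both.
squeeze : ∀ {p q r v : ℕ} → p ≢ q → v ≡ p ⊎ v ≡ r → v ≡ q ⊎ v ≡ r → v ≡ r
squeeze p≢q (inj₂ v≡r) _ = v≡r
squeeze p≢q (inj₁ v≡p) (inj₂ v≡r) = v≡r
squeeze p≢q (inj₁ v≡p) (inj₁ v≡q) = contradiction (trans (sym v≡p) v≡q) p≢q

link : ∀ {n} → Vec (Fin n) 7 → Fin 3 → Subset n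
link ψ i = toSet (mapTriple (lookup ψ) (edge LoosePath i))

-- Q = {x,y,z,w} comes last, so that outside vertices are consed onto a vector listing Q.
s t u x y z w : Fin 7
s = 0F
t = 1F
u = 2F
x = 3F
y = 4F
z = 5F
w = 6F

Distinct₃ : ℕ → ℕ → ℕ → Set
Distinct₃ p q r = p ≢ q × p ≢ r × q ≢ r

Base : Colouring 7 ℕ → Set
Base χ = Distinct₃ (χ (toSet (x , y , z))) (χ (toSet (x , y , w))) (χ (toSet (s , t , u)))

module Local (χ : Colouring 7 ℕ) (free : RainbowFree χ) where

  c : Fin 7 → Fin 7 → Fin 7 → ℕ
  c i j k = χ (toSet (i , j , k))

  A B C : ℕ
  A = c x y z
  B = c x y w
  C = c s t u

  no-rainbow : (ψ : Vec (Fin 7) 7) → Distinct ψ →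
    χ (link ψ 0F) ≢ χ (link ψ 1F) → χ (link ψ 0F) ≢ χ (link ψ 2F) →
    χ (link ψ 1F) ≡ χ (link ψ 2F)
  no-rainbow ψ dψ ne₀₁ ne₀₂ with χ (link ψ 1F) ℕ.≟ χ (link ψ 2F)
  ... | yes eq = eq
  ... | no ne₁₂ = contradiction (lookup ψ , (λ {i} {j} → dψ i j) , rainbow) free
    where
    rainbow : ∀ i j → χ (link ψ i) ≡ χ (link ψ j) → i ≡ j
    rainbow 0F 0F _ = refl
    rainbow 0F 1F e = contradiction e ne₀₁
    rainbow 0F 2F e = contradiction e ne₀₂
    rainbow 1F 0F e = contradiction (sym e) ne₀₁
    rainbow 1F 1F _ = refl
    rainbow 1F 2F e = contradiction e ne₁₂
    rainbow 2F 0F e = contradiction (sym e) ne₀₂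
    rainbow 2F 1F e = contradiction (sym e) ne₁₂
    rainbow 2F 2F _ = refl

  -- `ψ` lists the vertices of a loose path in order. The implicit `True` lets distinctness of a
  -- literal vector be settled by evaluation. `middle` does for the central edge what `end` does for
  -- the first.
  end : (ψ : Vec (Fin 7) 7) {_ : True (distinct? ψ)} → ∀ {p q} →
    χ (link ψ 1F) ≡ p → χ (link ψ 2F) ≡ q → p ≢ q →
    χ (link ψ 0F) ≡ p ⊎ χ (link ψ 0F) ≡ q
  end ψ {dψ} refl refl p≢q with χ (link ψ 0F) ℕ.≟ χ (link ψ 1F) | χ (link ψ 0F) ℕ.≟ χ (link ψ 2F)
  ... | yes e | _ = inj₁ e
  ... | _ | yes e = inj₂ e
  ... | no a | no b = contradiction (no-rainbow ψ (toWitness dψ) a b) p≢q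

  middle : (ψ : Vec (Fin 7) 7) {_ : True (distinct? ψ)} → ∀ {p q} →
    χ (link ψ 0F) ≡ p → χ (link ψ 2F) ≡ q → p ≢ q →
    χ (link ψ 1F) ≡ p ⊎ χ (link ψ 1F) ≡ q
  middle ψ {dψ} refl refl p≢q with χ (link ψ 1F) ℕ.≟ χ (link ψ 0F)
  ... | yes e = inj₁ e
  ... | no a = inj₂ (no-rainbow ψ (toWitness dψ) (a ∘ sym) p≢q)

  module _ (base : Base χ) where
    private
      A≢B : A ≢ B
      A≢B = proj₁ base
      A≢C : A ≢ C
      A≢C = proj₁ (proj₂ base)
      B≢C : B ≢ C
      B≢C = proj₂ (proj₂ base)

    -- The edge zws is the middle of two loose paths ending in stu, one beginning with xyz and one
    -- with xyw.
    zws≡C : c z w s ≡ C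
    zws≡C = squeeze A≢B
      (middle (x ∷ y ∷ z ∷ w ∷ s ∷ t ∷ u ∷ []) refl refl A≢C)
      (middle (x ∷ y ∷ w ∷ z ∷ s ∷ t ∷ u ∷ []) refl refl B≢C)

    xtu≡C : c x t u ≡ C
    xtu≡C = squeeze A≢B
      (end (t ∷ u ∷ x ∷ y ∷ z ∷ w ∷ s ∷ []) refl zws≡C A≢C)
      (end (t ∷ u ∷ x ∷ y ∷ w ∷ z ∷ s ∷ []) refl zws≡C B≢C)

    yst≡C : c y s t ≡ C
    yst≡C = squeeze A≢B
      (end (s ∷ t ∷ y ∷ x ∷ z ∷ w ∷ u ∷ []) refl zwu≡C A≢C)
      (end (s ∷ t ∷ y ∷ x ∷ w ∷ z ∷ u ∷ []) refl zwu≡C B≢C)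
      where
      zwu≡C : c z w u ≡ C
      zwu≡C = squeeze A≢B
        (middle (x ∷ y ∷ z ∷ w ∷ u ∷ s ∷ t ∷ []) refl refl A≢C)
        (middle (x ∷ y ∷ w ∷ z ∷ u ∷ s ∷ t ∷ []) refl refl B≢C)

    xws≡A⊎C : c x w s ≡ A ⊎ c x w s ≡ C
    xws≡A⊎C = middle (y ∷ z ∷ x ∷ w ∷ s ∷ t ∷ u ∷ []) refl refl A≢C

    -- The path tuz, zsw, wxy leaves only C and B. If ztu had colour B, the path wsx, xyz, ztu
    -- together with `xws≡A⊎C` would give xws colour A. Then zut, tys, sxw would have colours B, C,
    -- A.
    ztu≡C : c z t u ≡ C
    ztu≡C with end (t ∷ u ∷ z ∷ s ∷ w ∷ x ∷ y ∷ []) zws≡C refl (B≢C ∘ sym)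
    ... | inj₁ e = e
    ... | inj₂ ztu≡B with end (w ∷ s ∷ x ∷ y ∷ z ∷ t ∷ u ∷ []) refl ztu≡B A≢B | xws≡A⊎C
    ... | inj₂ xws≡B | inj₁ xws≡A = contradiction (trans (sym xws≡A) xws≡B) A≢B
    ... | inj₂ xws≡B | inj₂ xws≡C = contradiction (trans (sym xws≡B) xws≡C) B≢C
    ... | inj₁ xws≡A | _ with middle (z ∷ u ∷ t ∷ y ∷ s ∷ x ∷ w ∷ []) ztu≡B xws≡A (A≢B ∘ sym)
    ... | inj₁ yst≡B = contradiction (trans (sym yst≡B) yst≡C) B≢C
    ... | inj₂ yst≡A = contradiction (trans (sym yst≡A) yst≡C) A≢C

  private
    via-stu : ∀ {K} → c s t u ≡ K → Distinct₃ A B K → Base χ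
    via-stu refl d = d

  -- The third colour K is carried from ztu along wsu, xst, wuz to stu. Each step is squeezed
  -- between a path through xyz and a path through xyw.
  z-base : Distinct₃ A B (c z t u) → Base χ
  z-base (A≢B , A≢K , B≢K) = via-stu stu≡K (A≢B , A≢K , B≢K)
    where
    K = c z t u
    K≢A = A≢K ∘ sym
    K≢B = B≢K ∘ sym

    wsu≡K : c w s u ≡ K
    wsu≡K = squeeze A≢B
      (swap (end (w ∷ s ∷ u ∷ t ∷ z ∷ x ∷ y ∷ []) refl refl K≢A))
      (middle (x ∷ y ∷ w ∷ s ∷ u ∷ t ∷ z ∷ []) refl refl B≢K)

    xst≡K : c x s t ≡ K
    xst≡K = squeeze A≢B
      (middle (y ∷ z ∷ x ∷ t ∷ s ∷ u ∷ w ∷ []) refl wsu≡K A≢K)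
      (middle (y ∷ w ∷ x ∷ s ∷ t ∷ u ∷ z ∷ []) refl refl B≢K)

    wuz≡K : c w u z ≡ K
    wuz≡K = squeeze A≢B
      (end (w ∷ u ∷ z ∷ y ∷ x ∷ s ∷ t ∷ []) refl xst≡K A≢K)
      (end (z ∷ u ∷ w ∷ y ∷ x ∷ s ∷ t ∷ []) refl xst≡K B≢K)

    stu≡K : c s t u ≡ K
    stu≡K = squeeze A≢B
      (swap (end (s ∷ t ∷ u ∷ w ∷ z ∷ x ∷ y ∷ []) wuz≡K refl K≢A))
      (swap (end (s ∷ t ∷ u ∷ z ∷ w ∷ x ∷ y ∷ []) wuz≡K refl K≢B))

  -- The converse passage to `xtu≡C`, through the edge zsw. Besides producing base configurations,
  -- it lets the third colour spread among the triples outside Q.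
  stu≡xtu : Distinct₃ A B (c x t u) → c s t u ≡ c x t u
  stu≡xtu (A≢B , A≢K , B≢K) = squeeze A≢B
      (swap (end (t ∷ u ∷ s ∷ w ∷ z ∷ x ∷ y ∷ []) zsw≡K refl (A≢K ∘ sym)))
      (swap (end (t ∷ u ∷ s ∷ z ∷ w ∷ x ∷ y ∷ []) zsw≡K refl (B≢K ∘ sym)))
    where
    zsw≡K : c z s w ≡ c x t u
    zsw≡K = squeeze A≢B
      (end (w ∷ s ∷ z ∷ y ∷ x ∷ t ∷ u ∷ []) refl refl A≢K)
      (end (z ∷ s ∷ w ∷ y ∷ x ∷ t ∷ u ∷ []) refl refl B≢K)

  x-base : Distinct₃ A B (c x t u) → Base χ
  x-base d = via-stu (stu≡xtu d) d

mapTriple-select : ∀ {n m k} (v : Vec (Fin n) m) (ψ : Vec (Fin m) k) τ →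
  mapTriple (lookup v) (mapTriple (lookup ψ) τ) ≡ mapTriple (lookup (select v ψ)) τ
mapTriple-select v ψ (a , b , d) = sym (cong₂ _,_ (lk a) (cong₂ _,_ (lk b) (lk d)))
  where lk = λ i → lookup-map i (lookup v) ψ

⟨⟩-select : ∀ {n m k} (χ : Colouring n ℕ) (v : Vec (Fin n) m) (ψ : Vec (Fin m) k) τ →
  (χ ⟨ v ⟩ ⟨ ψ ⟩) (toSet τ) ≡ (χ ⟨ select v ψ ⟩) (toSet τ)
⟨⟩-select χ v ψ τ = begin
  (χ ⟨ v ⟩ ⟨ ψ ⟩) (toSet τ)                                  ≡⟨ ⟨⟩-toSet (χ ⟨ v ⟩) ψ τ ⟩
  (χ ⟨ v ⟩) (toSet (mapTriple (lookup ψ) τ))                 ≡⟨ ⟨⟩-toSet χ v (mapTriple (lookup ψ) τ) ⟩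
  χ (toSet (mapTriple (lookup v) (mapTriple (lookup ψ) τ)))  ≡⟨ cong (χ ∘ toSet) (mapTriple-select v ψ τ) ⟩
  χ (toSet (mapTriple (lookup (select v ψ)) τ))              ≡⟨ ⟨⟩-toSet χ (select v ψ) τ ⟨
  (χ ⟨ select v ψ ⟩) (toSet τ)                               ∎
  where open ≡-Reasoning

HasBase : ∀ {n} → Colouring n ℕ → Set
HasBase {n} χ = Σ (Vec (Fin n) 7) λ v → Distinct v × Base (χ ⟨ v ⟩)

⟨⟩-hasBase : ∀ {n m} (χ : Colouring n ℕ) (v : Vec (Fin n) m) → Distinct v →
  HasBase (χ ⟨ v ⟩) → HasBase χ
⟨⟩-hasBase χ v dv (ψ , dψ , A≢B , A≢C , B≢C) = select v ψ , select-distinct v ψ dv dψ ,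
  (λ e → A≢B (trans eA (trans e (sym eB)))) ,
  (λ e → A≢C (trans eA (trans e (sym eC)))) ,
  (λ e → B≢C (trans eB (trans e (sym eC))))
  where
  eA = ⟨⟩-select χ v ψ (x , y , z)
  eB = ⟨⟩-select χ v ψ (x , y , w)
  eC = ⟨⟩-select χ v ψ (s , t , u)

-- One representative of each orbit of edges of Fin 7 under permutations of s, t, u.
data Position : Triple 7 → Set where
  stu : Position (s , t , u)
  xtu : Position (x , t , u)
  ytu : Position (y , t , u)
  ztu : Position (z , t , u)
  wtu : Position (w , t , u)
  xys : Position (x , y , s)
  xzs : Position (x , z , s)
  xws : Position (x , w , s)
  yzs : Position (y , z , s)
  yws : Position (y , w , s)
  zws : Position (z , w , s)
  xyz : Position (x , y , z)
  xyw : Position (x , y , w)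
  xzw : Position (x , z , w)
  yzw : Position (y , z , w)

-- From three colours to a base configuration

decideBetween : ∀ {P : Set} (v p q : ℕ) → (v ≡ p → P) → (v ≡ q → P) → (p ≢ v → q ≢ v → P) → P
decideBetween v p q f g h with v ℕ.≟ p | v ℕ.≟ q
... | yes e | _ = f e
... | no _ | yes e = g e
... | no a | no b = h (a ∘ sym) (b ∘ sym)

module ThirdColour (χ : Colouring 7 ℕ) (free : RainbowFree χ) where
  open Local χ free

  private
    -- `ψ` names, in order, the vertices that take over the roles s, t, u, x, y, z, w.
    by-stu : (ψ : Vec (Fin 7) 7) {_ : True (distinct? ψ)} → Base (χ ⟨ ψ ⟩) → HasBase χ
    by-stu ψ {dψ} b = ψ , toWitness dψ , b

    by-xtu : (ψ : Vec (Fin 7) 7) {_ : True (distinct? ψ)} → let κ = χ ⟨ ψ ⟩ in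
      Distinct₃ (κ (toSet (x , y , z))) (κ (toSet (x , y , w))) (κ (toSet (x , t , u))) → HasBase χ
    by-xtu ψ {dψ} d = ψ , toWitness dψ ,
      Local.x-base (χ ⟨ ψ ⟩) (⟨⟩-rainbowFree χ ψ (toWitness dψ) free) d

    by-ztu : (ψ : Vec (Fin 7) 7) {_ : True (distinct? ψ)} → let κ = χ ⟨ ψ ⟩ in
      Distinct₃ (κ (toSet (x , y , z))) (κ (toSet (x , y , w))) (κ (toSet (z , t , u))) → HasBase χ
    by-ztu ψ {dψ} d = ψ , toWitness dψ ,
      Local.z-base (χ ⟨ ψ ⟩) (⟨⟩-rainbowFree χ ψ (toWitness dψ) free) d

  ofSTU : Distinct₃ A B (c s t u) → HasBase χ
  ofSTU = by-stu (s ∷ t ∷ u ∷ x ∷ y ∷ z ∷ w ∷ [])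

  ofXTU : Distinct₃ A B (c x t u) → HasBase χ
  ofXTU = by-xtu (s ∷ t ∷ u ∷ x ∷ y ∷ z ∷ w ∷ [])

  ofZTU : Distinct₃ A B (c z t u) → HasBase χ
  ofZTU = by-ztu (s ∷ t ∷ u ∷ x ∷ y ∷ z ∷ w ∷ [])

  -- An exchange of roles: unless the probing edge (here zst) already has a third colour, it agrees
  -- with A or B, and then the given edge and one of xyz, xyw play the parts of xyz and xyw.
  ofZWS : Distinct₃ A B (c z w s) → HasBase χ
  ofZWS (A≢B , A≢K , B≢K) = decideBetween (c z s t) A B
    (λ v≡A → by-ztu (u ∷ x ∷ y ∷ z ∷ s ∷ w ∷ t ∷ [])
      ((λ e → A≢K (sym (trans e v≡A))) , B≢K ∘ sym , λ e → A≢B (trans (sym v≡A) e)))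
    (λ v≡B → by-xtu (u ∷ x ∷ y ∷ z ∷ s ∷ w ∷ t ∷ [])
      ((λ e → B≢K (sym (trans e v≡B))) , A≢K ∘ sym , λ e → A≢B (sym (trans (sym v≡B) e))))
    (λ A≢v B≢v → by-ztu (u ∷ t ∷ s ∷ x ∷ y ∷ z ∷ w ∷ []) (A≢B , A≢v , B≢v))

  ofXZS : Distinct₃ A B (c x z s) → HasBase χ
  ofXZS (A≢B , A≢K , B≢K) = decideBetween (c s t u) A B
    -- Impossible: wyx, xzs, stu would be a loose path with colours B, K, A.
    (λ v≡A → [ (λ K≡B → contradiction (sym K≡B) B≢K) , (λ K≡A → contradiction (sym K≡A) A≢K) ]′
      (middle (w ∷ y ∷ x ∷ z ∷ s ∷ t ∷ u ∷ []) refl v≡A (A≢B ∘ sym)))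
    -- Here xzs and xzy, of colours K and A, share the pair xz, and stu supplies the third colour B.
    (λ v≡B → by-ztu (w ∷ t ∷ u ∷ x ∷ z ∷ s ∷ y ∷ [])
      (A≢K ∘ sym , (λ e → B≢K (sym (trans e v≡B))) , λ e → A≢B (trans e v≡B)))
    (λ A≢v B≢v → ofSTU (A≢B , A≢v , B≢v))

  -- The probing edge is xtu. If it repeats A or B, then xys replaces whichever of xyz, xyw has the
  -- repeated colour.
  ofXYS : Distinct₃ A B (c x y s) → HasBase χ
  ofXYS (A≢B , A≢K , B≢K) = decideBetween (c x t u) A B
    (λ v≡A → by-xtu (z ∷ t ∷ u ∷ x ∷ y ∷ w ∷ s ∷ [])
      (B≢K , (λ e → A≢B (sym (trans e v≡A))) , λ e → A≢K (sym (trans e v≡A))))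
    (λ v≡B → by-xtu (w ∷ t ∷ u ∷ x ∷ y ∷ z ∷ s ∷ [])
      (A≢K , (λ e → A≢B (trans e v≡B)) , λ e → B≢K (sym (trans e v≡B))))
    (λ A≢v B≢v → ofXTU (A≢B , A≢v , B≢v))

  -- As for xys, with stu as the probing edge; the pair shared by the two new principal edges is xw
  -- or xz.
  ofXZW : Distinct₃ A B (c x z w) → HasBase χ
  ofXZW (A≢B , A≢K , B≢K) = decideBetween (c s t u) A B
    (λ v≡A → by-stu (s ∷ t ∷ u ∷ x ∷ w ∷ y ∷ z ∷ [])
      (B≢K , (λ e → A≢B (sym (trans e v≡A))) , λ e → A≢K (sym (trans e v≡A))))
    (λ v≡B → by-stu (s ∷ t ∷ u ∷ x ∷ z ∷ y ∷ w ∷ [])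
      (A≢K , (λ e → A≢B (trans e v≡B)) , λ e → B≢K (sym (trans e v≡B))))
    (λ A≢v B≢v → ofSTU (A≢B , A≢v , B≢v))

module _ (χ : Colouring 7 ℕ) (free : RainbowFree χ) where

  private
    permuted : (ψ : Vec (Fin 7) 7) {_ : True (distinct? ψ)} {D : Set} →
      (RainbowFree (χ ⟨ ψ ⟩) → D → HasBase (χ ⟨ ψ ⟩)) → D → HasBase χ
    permuted ψ {dψ} of d = ⟨⟩-hasBase χ ψ (toWitness dψ) (of (⟨⟩-rainbowFree χ ψ (toWitness dψ) free) d)

    -- The symmetries of a base configuration. Exchanging z with w also exchanges A with B, hence
    -- the `flip` in those cases.
    xy↔yx zw↔wz both : Vec (Fin 7) 7
    xy↔yx = s ∷ t ∷ u ∷ y ∷ x ∷ z ∷ w ∷ []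
    zw↔wz = s ∷ t ∷ u ∷ x ∷ y ∷ w ∷ z ∷ []
    both  = s ∷ t ∷ u ∷ y ∷ x ∷ w ∷ z ∷ []

    flip : ∀ {p q r} → Distinct₃ p q r → Distinct₃ q p r
    flip (a , b , c) = a ∘ sym , c , b

  thirdColour-hasBase : ∀ {τ} → Position τ →
    Distinct₃ (χ (toSet (x , y , z))) (χ (toSet (x , y , w))) (χ (toSet τ)) → HasBase χ
  thirdColour-hasBase stu = ThirdColour.ofSTU χ free
  thirdColour-hasBase xtu = ThirdColour.ofXTU χ free
  thirdColour-hasBase ytu = permuted xy↔yx (ThirdColour.ofXTU (χ ⟨ xy↔yx ⟩))
  thirdColour-hasBase ztu = ThirdColour.ofZTU χ free
  thirdColour-hasBase wtu = permuted zw↔wz (ThirdColour.ofZTU (χ ⟨ zw↔wz ⟩)) ∘ flip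
  thirdColour-hasBase xys = ThirdColour.ofXYS χ free
  thirdColour-hasBase xzs = ThirdColour.ofXZS χ free
  thirdColour-hasBase xws = permuted zw↔wz (ThirdColour.ofXZS (χ ⟨ zw↔wz ⟩)) ∘ flip
  thirdColour-hasBase yzs = permuted xy↔yx (ThirdColour.ofXZS (χ ⟨ xy↔yx ⟩))
  thirdColour-hasBase yws = permuted both (ThirdColour.ofXZS (χ ⟨ both ⟩)) ∘ flip
  thirdColour-hasBase zws = ThirdColour.ofZWS χ free
  thirdColour-hasBase xyz (_ , A≢A , _) = contradiction refl A≢A
  thirdColour-hasBase xyw (_ , _ , B≢B) = contradiction refl B≢B
  thirdColour-hasBase xzw = ThirdColour.ofXZW χ free
  thirdColour-hasBase yzw = permuted xy↔yx (ThirdColour.ofXZW (χ ⟨ xy↔yx ⟩))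

-- Covering edges by seven vertices

Fresh : ∀ {n m} → Fin n → Vec (Fin n) m → Set
Fresh i v = ∀ j → lookup v j ≢ i

fresh? : ∀ {n m} i (v : Vec (Fin n) m) → Dec (Fresh i v)
fresh? i v = all? λ j → ¬? (lookup v j ≟ i)

fresh-∷ : ∀ {n m i j} {v : Vec (Fin n) m} → j ≢ i → Fresh i v → Fresh i (j ∷ v)
fresh-∷ j≢i fr zero    = j≢i
fresh-∷ j≢i fr (suc k) = fr k

distinct-∷ : ∀ {n m i} {v : Vec (Fin n) m} → Fresh i v → Distinct v → Distinct (i ∷ v)
distinct-∷ fr dv zero    zero    _ = refl
distinct-∷ fr dv zero    (suc j) e = contradiction (sym e) (fr j)
distinct-∷ fr dv (suc i) zero    e = contradiction e (fr i)
distinct-∷ fr dv (suc i) (suc j) e = cong suc (dv i j e)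

head-fresh : ∀ {n m i} {v : Vec (Fin n) m} → Distinct (i ∷ v) → Fresh i v
head-fresh dv j e with () ← dv (suc j) zero e

tail-distinct : ∀ {n m i} {v : Vec (Fin n) m} → Distinct (i ∷ v) → Distinct v
tail-distinct dv i j e with refl ← dv (suc i) (suc j) e = refl

distinct-swap : ∀ {n m i j} {v : Vec (Fin n) m} → Distinct (i ∷ j ∷ v) → Distinct (j ∷ i ∷ v)
distinct-swap dv = distinct-∷ (fresh-∷ (head-fresh dv zero ∘ sym) (head-fresh (tail-distinct dv)))
  (distinct-∷ (head-fresh dv ∘ suc) (tail-distinct (tail-distinct dv)))

-- If every vertex occurred in `v`, choosing a position for each would inject `Fin n` into `Fin m`.
fresh-exists : ∀ {n m} (v : Vec (Fin n) m) → m < n → ∃ λ i → Fresh i v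
fresh-exists v m<n with any? (λ i → fresh? i v)
... | yes found = found
... | no none = contradiction (injective⇒≤ {f = proj₁ ∘ position} inj) (ℕ.<⇒≱ m<n)
  where
  position : ∀ i → ∃ λ j → lookup v j ≡ i
  position i with any? (λ j → lookup v j ≟ i)
  ... | yes p = p
  ... | no np = contradiction (i , λ j e → np (j , e)) none

  inj : ∀ {i i′} → proj₁ (position i) ≡ proj₁ (position i′) → i ≡ i′
  inj {i} {i′} e = trans (sym (proj₂ (position i))) (trans (cong (lookup v) e) (proj₂ (position i′)))

-- A vertex already listed is replaced by a fresh one as padding, so three calls turn Q into exactly
-- seven vertices however the edge overlaps Q.
adjoin : ∀ {n m} (v : Vec (Fin n) m) → Distinct v → m < n → ∀ i →
  ∃ λ i′ → Distinct (i′ ∷ v) × ∃ λ j → lookup (i′ ∷ v) j ≡ i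
adjoin v dv m<n i with any? (λ j → lookup v j ≟ i)
... | yes (j , e) = let i′ , fr = fresh-exists v m<n in i′ , distinct-∷ fr dv , suc j , e
... | no np = i , distinct-∷ (λ j e → np (j , e)) dv , zero , refl

DistinctTriple : ∀ {n} → Triple n → Set
DistinctTriple (a , b , d) = a ≢ b × b ≢ d × a ≢ d

distinctTriple? : ∀ {n} (τ : Triple n) → Dec (DistinctTriple τ)
distinctTriple? (a , b , d) = ¬? (a ≟ b) ×-dec ¬? (b ≟ d) ×-dec ¬? (a ≟ d)

-- Classification of the edges on seven vertices

reorderings : List (Triple 7)
reorderings = toList
  ((s , t , u) ∷ (s , u , t) ∷ (t , s , u) ∷ (t , u , s) ∷ (u , s , t) ∷ (u , t , s) ∷ [])

positions : List (∃ Position)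
positions = toList (
  (_ , stu) ∷ (_ , xtu) ∷ (_ , ytu) ∷ (_ , ztu) ∷ (_ , wtu) ∷
  (_ , xys) ∷ (_ , xzs) ∷ (_ , xws) ∷ (_ , yzs) ∷ (_ , yws) ∷ (_ , zws) ∷
  (_ , xyz) ∷ (_ , xyw) ∷ (_ , xzw) ∷ (_ , yzw) ∷ [])

reordering : Triple 7 → Vec (Fin 7) 7
reordering (a , b , d) = a ∷ b ∷ d ∷ x ∷ y ∷ z ∷ w ∷ []

-- Compared as sets, because the given edge may list its vertices in any order.
Classified : Triple 7 → Set
Classified τ = Any.Any (λ ρ → Distinct (reordering ρ) × Any.Any (λ π →
  toSet τ ≡ toSet (mapTriple (lookup (reordering ρ)) (proj₁ π))) positions) reorderings

classified? : ∀ τ → Dec (Classified τ)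
classified? τ = Any.any? (λ ρ → distinct? (reordering ρ) ×-dec
  Any.any? (λ π → ≡-dec Bool._≟_ (toSet τ) (toSet (mapTriple (lookup (reordering ρ)) (proj₁ π))))
    positions) reorderings

-- Abstract because `with` would otherwise normalise the exhaustive search.
abstract
  classify : ∀ a b d → DistinctTriple (a , b , d) → Classified (a , b , d)
  classify = from-yes (all? λ a → all? λ b → all? λ d →
    distinctTriple? (a , b , d) →-dec classified? (a , b , d))

record Cover {n} (q : Vec (Fin n) 4) (τ : Triple n) : Set where
  constructor cover
  field
    {s′ t′ u′} : Fin n
    distinct-stuq : Distinct (s′ ∷ t′ ∷ u′ ∷ q)
    {ρ} : Triple 7
    position : Position ρ
    toSet-≡ : toSet τ ≡ toSet (mapTriple (lookup (s′ ∷ t′ ∷ u′ ∷ q)) ρ)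

covered : ∀ {n} → 7 ≤ n → (q : Vec (Fin n) 4) → Distinct q → ∀ τ → DistinctTriple τ → Cover q τ
covered 7≤n q@(_ ∷ _ ∷ _ ∷ _ ∷ []) dq (a , b , d) (a≢b , b≢d , a≢d)
  with a₁ , da , ja , refl ← adjoin q dq (ℕ.≤-trans (ℕ.m≤m+n 5 2) 7≤n) a
  with b₁ , db , jb , refl ← adjoin (a₁ ∷ q) da (ℕ.≤-trans (ℕ.m≤m+n 6 1) 7≤n) b
  with d₁ , dd , jd , refl ← adjoin (b₁ ∷ a₁ ∷ q) db 7≤n d
  -- The later adjunctions shift the index of the first vertex by two and that of the second by one.
  with ρ , dρ , found ← Any.satisfied (classify (suc (suc ja)) (suc jb) jd
         (a≢b ∘ cong (lookup (d₁ ∷ b₁ ∷ a₁ ∷ q)) , b≢d ∘ cong (lookup (d₁ ∷ b₁ ∷ a₁ ∷ q)) ,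
          a≢d ∘ cong (lookup (d₁ ∷ b₁ ∷ a₁ ∷ q))))
  with (π , pos) , eq ← Any.satisfied found
  = cover (select-distinct v (reordering ρ) dd dρ) pos (begin
      toSet (mapTriple (lookup v) ι)                            ≡⟨ image-toSet (lookup v) ι ⟨
      image (lookup v) (toSet ι)                                ≡⟨ cong (image (lookup v)) eq ⟩
      image (lookup v) (toSet (mapTriple (lookup r) π))         ≡⟨ image-toSet (lookup v) (mapTriple (lookup r) π) ⟩
      toSet (mapTriple (lookup v) (mapTriple (lookup r) π))     ≡⟨ cong toSet (mapTriple-select v r π) ⟩
      toSet (mapTriple (lookup (select v r)) π)                 ∎)
  where
  open ≡-Reasoning
  v = d₁ ∷ b₁ ∷ a₁ ∷ q
  r = reordering ρ
  ι = suc (suc ja) , suc jb , jd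

toSet-swapˡ : ∀ {n} (a b d : Fin n) → toSet (a , b , d) ≡ toSet (b , a , d)
toSet-swapˡ {n} a b d = solve 3 (λ a b d → a ⊕ (b ⊕ d) ⊜ b ⊕ (a ⊕ d)) refl ⁅ a ⁆ ⁅ b ⁆ ⁅ d ⁆
  where open Solver (∪-idempotentCommutativeMonoid n)

toSet-swapʳ : ∀ {n} (a b d : Fin n) → toSet (a , b , d) ≡ toSet (a , d , b)
toSet-swapʳ a b d = cong (⁅ a ⁆ ∪_) (∪-comm ⁅ b ⁆ ⁅ d ⁆)

-- Connectedness of the graph of triples outside q under replacing one vertex.
module Exchange {n m} (χ : Colouring n ℕ) (q : Vec (Fin n) m) (C : ℕ) where

  private
    record Good (a b d : Fin n) : Set where
      constructor good
      field
        distinct-abd : Distinct (a ∷ b ∷ d ∷ q)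
        coloured : χ (toSet (a , b , d)) ≡ C

    good-swapˡ : ∀ {a b d} → Good a b d → Good b a d
    good-swapˡ {a} {b} {d} (good da e) = good (distinct-swap da) (trans (cong χ (toSet-swapˡ b a d)) e)

    good-swapʳ : ∀ {a b d} → Good a b d → Good a d b
    good-swapʳ {a} {b} {d} (good da e) = good
      (distinct-∷ (fresh-∷ (head-fresh da 1F) (fresh-∷ (head-fresh da 0F) (λ j → head-fresh da (suc (suc j)))))
        (distinct-swap (tail-distinct da)))
      (trans (cong χ (toSet-swapʳ a d b)) e)

  module _ (exchange : ∀ a a′ b d → Distinct (a ∷ b ∷ d ∷ q) → Distinct (a′ ∷ b ∷ d ∷ q) →
              χ (toSet (a , b , d)) ≡ C → χ (toSet (a′ , b , d)) ≡ C) where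

    private
      replace : ∀ {a b d} a′ → b ≢ a′ → d ≢ a′ → Fresh a′ q → Good a b d → Good a′ b d
      replace a′ b≢ d≢ fr (good da e) = good da′ (exchange _ a′ _ _ da da′ e)
        where da′ = distinct-∷ (fresh-∷ b≢ (fresh-∷ d≢ fr)) (tail-distinct da)

      first : ∀ {a b d} a′ → Fresh a′ q → Good a b d → ∃ λ b′ → ∃ λ d′ → Good a′ b′ d′
      first {a} {b} {d} a′ fr g with b ≟ a′ | d ≟ a′
      ... | yes refl | _ = a , d , good-swapˡ g
      ... | no _ | yes refl = a , b , good-swapˡ (good-swapʳ g)
      ... | no b≢ | no d≢ = b , d , replace a′ b≢ d≢ fr g

      second : ∀ {a b d} b′ → a ≢ b′ → Fresh b′ q → Good a b d → ∃ λ d′ → Good a b′ d′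
      second {a} {b} {d} b′ a≢ fr g with d ≟ b′
      ... | yes refl = b , good-swapʳ g
      ... | no d≢ = d , good-swapˡ (replace b′ a≢ d≢ fr (good-swapˡ g))

      third : ∀ {a b d} d′ → a ≢ d′ → b ≢ d′ → Fresh d′ q → Good a b d → Good a b d′
      third d′ a≢ b≢ fr g =
        good-swapʳ (good-swapˡ (replace d′ a≢ b≢ fr (good-swapˡ (good-swapʳ g))))

    -- The vertices `a′`, `b′`, `d′` are brought in one after another. In `first` and `second`, a
    -- vertex already present is only moved to its place.
    spread : ∀ {a b d} → Distinct (a ∷ b ∷ d ∷ q) → χ (toSet (a , b , d)) ≡ C →
      ∀ a′ b′ d′ → Distinct (a′ ∷ b′ ∷ d′ ∷ q) → χ (toSet (a′ , b′ , d′)) ≡ C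
    spread da e a′ b′ d′ da′
      with _ , _ , g₁ ← first a′ (λ j → head-fresh da′ (suc (suc j))) (good da e)
      with _ , g₂ ← second b′ (head-fresh da′ 0F ∘ sym) (λ j → head-fresh (tail-distinct da′) (suc j)) g₁
      = Good.coloured (third d′ (head-fresh da′ 1F ∘ sym) (head-fresh (tail-distinct da′) 0F ∘ sym)
          (head-fresh (tail-distinct (tail-distinct da′))) g₂)

-- Two edges of different colours sharing two vertices

distinct-triple : ∀ {n} {a b d : Fin n} → DistinctTriple (a , b , d) → Distinct (a ∷ b ∷ d ∷ [])
distinct-triple (a≢b , b≢d , a≢d) = distinct-∷ (fresh-∷ (a≢b ∘ sym) (fresh-∷ (a≢d ∘ sym) λ ()))
  (distinct-∷ (fresh-∷ (b≢d ∘ sym) λ ()) (distinct-∷ (λ ()) λ ()))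

Adjacent : ∀ {n} → Colouring n ℕ → (x y z w : Fin n) → Set
Adjacent χ x y z w = Distinct (x ∷ y ∷ z ∷ w ∷ []) × χ (toSet (x , y , z)) ≢ χ (toSet (x , y , w))

-- Otherwise replacing one vertex of an edge never changes its colour, and `Exchange.spread` with
-- empty `q` gives every edge the colour of `σ`.
adjacent-exists : ∀ {n} (χ : Colouring n ℕ) (σ τ : Triple n) → DistinctTriple σ → DistinctTriple τ →
  χ (toSet σ) ≢ χ (toSet τ) → ∃ λ x → ∃ λ y → ∃ λ z → ∃ λ w → Adjacent χ x y z w
adjacent-exists χ σ@(_ , _ , _) τ@(a′ , b′ , d′) dσ dτ σ≢τ
  with any? (λ x → any? λ y → any? λ z → any? λ w → distinct? (x ∷ y ∷ z ∷ w ∷ []) ×-dec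
         ¬? (χ (toSet (x , y , z)) ℕ.≟ χ (toSet (x , y , w))))
... | yes found = found
... | no none = contradiction
  (sym (Exchange.spread χ [] (χ (toSet σ)) exchange (distinct-triple dσ) refl a′ b′ d′ (distinct-triple dτ)))
  σ≢τ
  where
  rotate : ∀ a b d → toSet (a , b , d) ≡ toSet (b , d , a)
  rotate a b d = trans (toSet-swapˡ a b d) (toSet-swapʳ b a d)

  exchange : ∀ a a′ b d → Distinct (a ∷ b ∷ d ∷ []) → Distinct (a′ ∷ b ∷ d ∷ []) →
    χ (toSet (a , b , d)) ≡ χ (toSet σ) → χ (toSet (a′ , b , d)) ≡ χ (toSet σ)
  exchange a a′ b d da da′ e with a ≟ a′
  -- `Exchange` may replace a vertex by itself, and then there are no four distinct vertices to
  -- consider.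
  ... | yes refl = e
  ... | no a≢a′ with χ (toSet (b , d , a)) ℕ.≟ χ (toSet (b , d , a′))
  ... | yes same = trans (cong χ (rotate a′ b d)) (trans (sym same) (trans (sym (cong χ (rotate a b d))) e))
  ... | no differ = contradiction (b , d , a , a′ , distinct-bdaa′ , differ) none
    where
    distinct-bdaa′ : Distinct (b ∷ d ∷ a ∷ a′ ∷ [])
    distinct-bdaa′ = distinct-∷
      (fresh-∷ (head-fresh (tail-distinct da) 0F)
        (fresh-∷ (head-fresh da 0F ∘ sym) (fresh-∷ (head-fresh da′ 0F ∘ sym) λ ())))
      (distinct-∷ (fresh-∷ (head-fresh da 1F ∘ sym) (fresh-∷ (head-fresh da′ 1F ∘ sym) λ ()))
        (distinct-∷ (fresh-∷ (a≢a′ ∘ sym) λ ()) (distinct-∷ (λ ()) λ ())))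

-- The dominant colour

distinct₃-resp : ∀ {p p′ q q′ r r′} → p ≡ p′ → q ≡ q′ → r ≡ r′ → Distinct₃ p q r → Distinct₃ p′ q′ r′
distinct₃-resp refl refl refl d = d

-- Used to choose, among three edges of distinct colours, one whose colour differs from both A and
-- B.
avoids-both : ∀ {p q r} (a b : ℕ) → p ≢ q → p ≢ r → q ≢ r →
  (a ≢ p × b ≢ p) ⊎ (a ≢ q × b ≢ q) ⊎ (a ≢ r × b ≢ r)
avoids-both {p} {q} {r} a b p≢q p≢r q≢r with a ℕ.≟ p | b ℕ.≟ p
... | no ap | no bp = inj₁ (ap , bp)
... | yes refl | _ with b ℕ.≟ q
... | no bq = inj₂ (inj₁ (p≢q , bq))
... | yes refl = inj₂ (inj₂ (p≢r , q≢r))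
avoids-both {p} {q} {r} a b p≢q p≢r q≢r | no _ | yes refl with a ℕ.≟ q
... | no aq = inj₂ (inj₁ (aq , p≢q))
... | yes refl = inj₂ (inj₂ (q≢r , p≢r))

hasBase : ∀ {n} (χ : Colouring n ℕ) → RainbowFree χ → 7 ≤ n → ∀ σ τ υ →
  DistinctTriple σ → DistinctTriple τ → DistinctTriple υ →
  χ (toSet σ) ≢ χ (toSet τ) → χ (toSet σ) ≢ χ (toSet υ) → χ (toSet τ) ≢ χ (toSet υ) → HasBase χ
hasBase χ free 7≤n σ τ υ dσ dτ dυ σ≢τ σ≢υ τ≢υ
  with x′ , y′ , z′ , w′ , dq , A≢B ← adjacent-exists χ σ τ dσ dτ σ≢τ
  = [ from σ dσ , [ from τ dτ , from υ dυ ]′ ]′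
      (avoids-both (χ (toSet (x′ , y′ , z′))) (χ (toSet (x′ , y′ , w′))) σ≢τ σ≢υ τ≢υ)
  where
  from : ∀ ω → DistinctTriple ω →
    χ (toSet (x′ , y′ , z′)) ≢ χ (toSet ω) × χ (toSet (x′ , y′ , w′)) ≢ χ (toSet ω) → HasBase χ
  from ω dω (A≢ω , B≢ω) with cover {s′} {t′} {u′} dv {ρ} pos eq ← covered 7≤n _ dq ω dω =
    ⟨⟩-hasBase χ v dv (thirdColour-hasBase (χ ⟨ v ⟩) (⟨⟩-rainbowFree χ v dv free) pos
      (distinct₃-resp (sym (⟨⟩-toSet χ v (x , y , z))) (sym (⟨⟩-toSet χ v (x , y , w)))
        (trans (cong χ eq) (sym (⟨⟩-toSet χ v ρ))) (A≢B , A≢ω , B≢ω)))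
    where v = s′ ∷ t′ ∷ u′ ∷ x′ ∷ y′ ∷ z′ ∷ w′ ∷ []

record Dominant {n} (χ : Colouring n ℕ) (C : ℕ) (x′ y′ z′ w′ : Fin n) : Set where
  constructor dominant
  field
    quad-distinct : Distinct (x′ ∷ y′ ∷ z′ ∷ w′ ∷ [])
    colours       : Distinct₃ (χ (toSet (x′ , y′ , z′))) (χ (toSet (x′ , y′ , w′))) C
    outside-≡     : ∀ a b d → Distinct (a ∷ b ∷ d ∷ x′ ∷ y′ ∷ z′ ∷ w′ ∷ []) → χ (toSet (a , b , d)) ≡ C

-- The base gives colour C to one triple outside Q. To replace `a` by `a′`, pass through the edge
-- `x′`, `b`, `d`: `xtu≡C` carries C to it and `stu≡xtu` carries C away from it.
dominant-exists : ∀ {n} (χ : Colouring n ℕ) → RainbowFree χ → HasBase χ →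
  ∃ λ C → ∃ λ x′ → ∃ λ y′ → ∃ λ z′ → ∃ λ w′ → Dominant χ C x′ y′ z′ w′
dominant-exists χ free (v@(s′ ∷ t′ ∷ u′ ∷ x′ ∷ y′ ∷ z′ ∷ w′ ∷ []) , dv , base) =
  C , x′ , y′ , z′ , w′ , dominant (tail-distinct (tail-distinct (tail-distinct dv))) colours
    (Exchange.spread χ q C exchange dv refl)
  where
  q = x′ ∷ y′ ∷ z′ ∷ w′ ∷ []
  C = χ (toSet (s′ , t′ , u′))

  colours : Distinct₃ (χ (toSet (x′ , y′ , z′))) (χ (toSet (x′ , y′ , w′))) C
  colours = distinct₃-resp (⟨⟩-toSet χ v (x , y , z)) (⟨⟩-toSet χ v (x , y , w))
    (⟨⟩-toSet χ v (s , t , u)) base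

  exchange : ∀ a a′ b d → Distinct (a ∷ b ∷ d ∷ q) → Distinct (a′ ∷ b ∷ d ∷ q) →
    χ (toSet (a , b , d)) ≡ C → χ (toSet (a′ , b , d)) ≡ C
  exchange a a′ b d da da′ e = begin
    χ (toSet (a′ , b , d))           ≡⟨ ⟨⟩-toSet χ v₁ (s , t , u) ⟨
    (χ ⟨ v₁ ⟩) (toSet (s , t , u))   ≡⟨ Local.stu≡xtu (χ ⟨ v₁ ⟩) (⟨⟩-rainbowFree χ v₁ da′ free)
                                          (distinct₃-resp (sym (⟨⟩-toSet χ v₁ (x , y , z)))
                                            (sym (⟨⟩-toSet χ v₁ (x , y , w)))
                                            (sym (trans (⟨⟩-toSet χ v₁ (x , t , u)) xbd≡C)) colours) ⟩
    (χ ⟨ v₁ ⟩) (toSet (x , t , u))   ≡⟨ ⟨⟩-toSet χ v₁ (x , t , u) ⟩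
    χ (toSet (x′ , b , d))           ≡⟨ xbd≡C ⟩
    C                                ∎
    where
    open ≡-Reasoning
    v₀ = a ∷ b ∷ d ∷ q
    v₁ = a′ ∷ b ∷ d ∷ q
    xbd≡C : χ (toSet (x′ , b , d)) ≡ C
    xbd≡C = begin
      χ (toSet (x′ , b , d))         ≡⟨ ⟨⟩-toSet χ v₀ (x , t , u) ⟨
      (χ ⟨ v₀ ⟩) (toSet (x , t , u)) ≡⟨ Local.xtu≡C (χ ⟨ v₀ ⟩) (⟨⟩-rainbowFree χ v₀ da free)
                                          (distinct₃-resp (sym (⟨⟩-toSet χ v₀ (x , y , z)))
                                            (sym (⟨⟩-toSet χ v₀ (x , y , w)))
                                            (sym (trans (⟨⟩-toSet χ v₀ (s , t , u)) e)) colours) ⟩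
      (χ ⟨ v₀ ⟩) (toSet (s , t , u)) ≡⟨ ⟨⟩-toSet χ v₀ (s , t , u) ⟩
      χ (toSet (a , b , d))          ≡⟨ e ⟩
      C                              ∎

-- This concerns the pair formed by the first and last of the four vertices; the middle two only
-- complete Q. Permuting the arguments gives the pairs xz, yw and yz, in step with the symmetries of
-- `Dominant`.
Exposed : ∀ {n} → Colouring n ℕ → ℕ → (x′ y′ z′ w′ : Fin n) → Set
Exposed χ C x′ y′ z′ w′ = ∃ λ s′ → Fresh s′ (x′ ∷ y′ ∷ z′ ∷ w′ ∷ []) × χ (toSet (x′ , w′ , s′)) ≢ C

exposed? : ∀ {n} (χ : Colouring n ℕ) C x′ y′ z′ w′ → Dec (Exposed χ C x′ y′ z′ w′)
exposed? χ C x′ y′ z′ w′ = any? λ s′ →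
  fresh? s′ (x′ ∷ y′ ∷ z′ ∷ w′ ∷ []) ×-dec ¬? (χ (toSet (x′ , w′ , s′)) ℕ.≟ C)

complete : ∀ {n} {q : Vec (Fin n) 4} {s′} → 7 ≤ n → Distinct q → Fresh s′ q →
  ∃ λ t′ → ∃ λ u′ → Distinct (s′ ∷ t′ ∷ u′ ∷ q)
complete {q = q} {s′} 7≤n dq fr
  with u′ , fu ← fresh-exists (s′ ∷ q) (ℕ.≤-trans (ℕ.m≤m+n 6 1) 7≤n)
  with t′ , ft ← fresh-exists (s′ ∷ u′ ∷ q) 7≤n
  = t′ , u′ , distinct-swap (distinct-∷ ft (distinct-swap (distinct-∷ fu (distinct-∷ fr dq))))

complete₂ : ∀ {n} {q : Vec (Fin n) 4} {s′ t′} → 7 ≤ n → Distinct q → Fresh s′ q → Fresh t′ q →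
  t′ ≢ s′ → ∃ λ u′ → Distinct (s′ ∷ t′ ∷ u′ ∷ q)
complete₂ {q = q} {s′} {t′} 7≤n dq fs ft t≢s
  with u′ , fu ← fresh-exists (s′ ∷ t′ ∷ q) 7≤n
  = u′ , distinct-∷ (fresh-∷ t≢s (fresh-∷ (fu 0F ∘ sym) fs))
      (distinct-∷ (fresh-∷ (fu 1F ∘ sym) ft) (distinct-∷ (λ j → fu (suc (suc j))) dq))

-- Edges meeting a set twice, and permutations moving listed vertices

toSet-injects : ∀ {n} {a b d i j k : Fin n} → toSet (a , b , d) ≡ toSet (i , j , k) →
  i ≡ a ⊎ i ≡ b ⊎ i ≡ d
toSet-injects {a = a} {b} {d} {i} e = Sum.map (x∈⁅y⁆⇒x≡y a) (Sum.map (x∈⁅y⁆⇒x≡y b) (x∈⁅y⁆⇒x≡y d)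
  ∘ x∈p∪q⁻ ⁅ b ⁆ ⁅ d ⁆) (x∈p∪q⁻ ⁅ a ⁆ _ (subst (i ∈_) (sym e) (x∈p∪q⁺ (inj₁ (x∈⁅x⁆ i)))))

TwoOf : ∀ {n} → (Fin n → Set) → Triple n → Set
TwoOf P (a , b , d) = (P a × P b) ⊎ (P b × P d) ⊎ (P a × P d)

twoOf : ∀ {n} (P : Fin n → Set) {a b d i j k : Fin n} → toSet (a , b , d) ≡ toSet (i , j , k) →
  i ≢ j → P i → P j → TwoOf P (a , b , d)
twoOf P {i = i} {j} {k} e i≢j pi pj
  with toSet-injects e | toSet-injects (trans e (toSet-swapˡ i j k))
... | inj₁ refl        | inj₁ refl        = contradiction refl i≢j
... | inj₁ refl        | inj₂ (inj₁ refl) = inj₁ (pi , pj)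
... | inj₁ refl        | inj₂ (inj₂ refl) = inj₂ (inj₂ (pi , pj))
... | inj₂ (inj₁ refl) | inj₁ refl        = inj₁ (pj , pi)
... | inj₂ (inj₁ refl) | inj₂ (inj₁ refl) = contradiction refl i≢j
... | inj₂ (inj₁ refl) | inj₂ (inj₂ refl) = inj₂ (inj₁ (pi , pj))
... | inj₂ (inj₂ refl) | inj₁ refl        = inj₂ (inj₂ (pj , pi))
... | inj₂ (inj₂ refl) | inj₂ (inj₁ refl) = inj₂ (inj₁ (pj , pi))
... | inj₂ (inj₂ refl) | inj₂ (inj₂ refl) = contradiction refl i≢j

-- Two pairs among three positions have a position in common.
twoOf-clash : ∀ {n} {P Q : Fin n → Set} → (∀ i → P i → ¬ Q i) → ∀ {τ} → TwoOf P τ → ¬ TwoOf Q τ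
twoOf-clash clash (inj₁ (pa , pb)) (inj₁ (qa , _)) = clash _ pa qa
twoOf-clash clash (inj₁ (pa , pb)) (inj₂ (inj₁ (qb , _))) = clash _ pb qb
twoOf-clash clash (inj₁ (pa , pb)) (inj₂ (inj₂ (qa , _))) = clash _ pa qa
twoOf-clash clash (inj₂ (inj₁ (pb , pd))) (inj₁ (_ , qb)) = clash _ pb qb
twoOf-clash clash (inj₂ (inj₁ (pb , pd))) (inj₂ (inj₁ (qb , _))) = clash _ pb qb
twoOf-clash clash (inj₂ (inj₁ (pb , pd))) (inj₂ (inj₂ (_ , qd))) = clash _ pd qd
twoOf-clash clash (inj₂ (inj₂ (pa , pd))) (inj₁ (qa , _)) = clash _ pa qa
twoOf-clash clash (inj₂ (inj₂ (pa , pd))) (inj₂ (inj₁ (_ , qd))) = clash _ pd qd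
twoOf-clash clash (inj₂ (inj₂ (pa , pd))) (inj₂ (inj₂ (qa , _))) = clash _ pa qa

-- The index map `ρ` transported to the vertices listed by `v` and extended by the identity
-- elsewhere.
module Along {n m} (v : Vec (Fin n) m) (dv : Distinct v) (ρ : Fin m → Fin m) where

  along : Fin n → Fin n
  along i with any? (λ j → lookup v j ≟ i)
  ... | yes (j , _) = lookup v (ρ j)
  ... | no _        = i

  along-lookup : ∀ j → along (lookup v j) ≡ lookup v (ρ j)
  along-lookup j with any? (λ j′ → lookup v j′ ≟ lookup v j)
  ... | yes (j′ , e) = cong (lookup v ∘ ρ) (dv j′ j e)
  ... | no none      = contradiction (j , refl) none

  along-involutive : (∀ j → ρ (ρ j) ≡ j) → ∀ i → along (along i) ≡ i
  along-involutive ρρ i with any? (λ j → lookup v j ≟ i) in eq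
  ... | yes (j , refl) = trans (along-lookup (ρ j)) (cong (lookup v) (ρρ j))
  ... | no none rewrite eq = refl

  along-injective : (∀ j → ρ (ρ j) ≡ j) → Injective _≡_ _≡_ along
  along-injective ρρ e = trans (sym (along-involutive ρρ _)) (trans (cong along e) (along-involutive ρρ _))

-- Symmetries and forced colours of a dominant configuration

permute-distinct : ∀ {n m k} (v : Vec (Fin n) m) (ψ : Vec (Fin m) k) {_ : True (distinct? ψ)} →
  Distinct v → Distinct (select v ψ)
permute-distinct v ψ {dψ} dv = select-distinct v ψ dv (toWitness dψ)

fresh-swapXY : ∀ {n} {i a b d e : Fin n} →
  Fresh i (a ∷ b ∷ d ∷ e ∷ []) → Fresh i (b ∷ a ∷ d ∷ e ∷ [])
fresh-swapXY fr 0F = fr 1F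
fresh-swapXY fr 1F = fr 0F
fresh-swapXY fr 2F = fr 2F
fresh-swapXY fr 3F = fr 3F

fresh-swapZW : ∀ {n} {i a b d e : Fin n} →
  Fresh i (a ∷ b ∷ d ∷ e ∷ []) → Fresh i (a ∷ b ∷ e ∷ d ∷ [])
fresh-swapZW fr 0F = fr 0F
fresh-swapZW fr 1F = fr 1F
fresh-swapZW fr 2F = fr 3F
fresh-swapZW fr 3F = fr 2F

module _ {n} {χ : Colouring n ℕ} {C : ℕ} {x′ y′ z′ w′ : Fin n}
  (D : Dominant χ C x′ y′ z′ w′) where

  open Dominant D

  dominant-swapXY : Dominant χ C y′ x′ z′ w′
  dominant-swapXY = dominant (distinct-swap quad-distinct)
    (distinct₃-resp (cong χ (toSet-swapˡ x′ y′ z′)) (cong χ (toSet-swapˡ x′ y′ w′)) refl colours)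
    (λ a b d dv → outside-≡ a b d
      (permute-distinct (a ∷ b ∷ d ∷ y′ ∷ x′ ∷ z′ ∷ w′ ∷ []) (s ∷ t ∷ u ∷ y ∷ x ∷ z ∷ w ∷ []) dv))

  dominant-swapZW : Dominant χ C x′ y′ w′ z′
  dominant-swapZW = dominant
    (permute-distinct (x′ ∷ y′ ∷ z′ ∷ w′ ∷ []) (0F ∷ 1F ∷ 3F ∷ 2F ∷ []) quad-distinct)
    (proj₁ colours ∘ sym , proj₂ (proj₂ colours) , proj₁ (proj₂ colours))
    (λ a b d dv → outside-≡ a b d
      (permute-distinct (a ∷ b ∷ d ∷ x′ ∷ y′ ∷ w′ ∷ z′ ∷ []) (s ∷ t ∷ u ∷ x ∷ y ∷ w ∷ z ∷ []) dv))

module Facts {n} (χ : Colouring n ℕ) (free : RainbowFree χ) {C : ℕ} {x′ y′ z′ w′ : Fin n}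
  (D : Dominant χ C x′ y′ z′ w′) where

  open Dominant D

  A B : ℕ
  A = χ (toSet (x′ , y′ , z′))
  B = χ (toSet (x′ , y′ , w′))

  q : Vec (Fin n) 4
  q = x′ ∷ y′ ∷ z′ ∷ w′ ∷ []

  module _ (s′ t′ u′ : Fin n) (dv : Distinct (s′ ∷ t′ ∷ u′ ∷ q)) where

    v : Vec (Fin n) 7
    v = s′ ∷ t′ ∷ u′ ∷ q

    pull : ∀ τ {p} → χ (toSet (mapTriple (lookup v) τ)) ≡ p → (χ ⟨ v ⟩) (toSet τ) ≡ p
    pull τ = trans (⟨⟩-toSet χ v τ)

    push : ∀ τ {p} → (χ ⟨ v ⟩) (toSet τ) ≡ p → χ (toSet (mapTriple (lookup v) τ)) ≡ p
    push τ = trans (sym (⟨⟩-toSet χ v τ))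

    stu-C : (χ ⟨ v ⟩) (toSet (s , t , u)) ≡ C
    stu-C = pull (s , t , u) (outside-≡ s′ t′ u′ dv)

    base : Base (χ ⟨ v ⟩)
    base = distinct₃-resp (sym (⟨⟩-toSet χ v (x , y , z))) (sym (⟨⟩-toSet χ v (x , y , w)))
      (sym stu-C) colours

    module L = Local (χ ⟨ v ⟩) (⟨⟩-rainbowFree χ v dv free)

    xtu-C : (χ ⟨ v ⟩) (toSet (x , t , u)) ≡ C
    xtu-C = trans (L.xtu≡C base) stu-C

    ztu-C : (χ ⟨ v ⟩) (toSet (z , t , u)) ≡ C
    ztu-C = trans (L.ztu≡C base) stu-C

    zws-C : (χ ⟨ v ⟩) (toSet (z , w , s)) ≡ C
    zws-C = trans (L.zws≡C base) stu-C

    xws-A : χ (toSet (x′ , w′ , s′)) ≢ C → (χ ⟨ v ⟩) (toSet (x , w , s)) ≡ A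
    xws-A ≢C = [ (λ e → trans e (⟨⟩-toSet χ v (x , y , z))) ,
                 (λ e → contradiction (push (x , w , s) (trans e stu-C)) ≢C) ]′ (L.xws≡A⊎C base)

  -- So the colour on an exposed pair is known: after the symmetries it is A on xw and yw, and B on
  -- xz and yz.
  exposed-A : 7 ≤ n → ∀ {s′} → Fresh s′ q → χ (toSet (x′ , w′ , s′)) ≢ C → χ (toSet (x′ , w′ , s′)) ≡ A
  exposed-A 7≤n fr ≢C with t′ , u′ , dv ← complete 7≤n quad-distinct fr =
    push _ _ _ dv (x , w , s) (xws-A _ _ _ dv ≢C)

  -- The exposed edge has colour A and is the middle of the loose path yzw, wxs, stu, whose last
  -- edge has colour C.
  yzw-AC : 7 ≤ n → Exposed χ C x′ y′ z′ w′ →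
    χ (toSet (y′ , z′ , w′)) ≡ A ⊎ χ (toSet (y′ , z′ , w′)) ≡ C
  yzw-AC 7≤n (s′ , fr , ≢C) with t′ , u′ , dv ← complete 7≤n quad-distinct fr =
    Sum.map (push _ _ _ dv (y , z , w)) (push _ _ _ dv (y , z , w))
      (L.end _ _ _ dv (y ∷ z ∷ w ∷ x ∷ s ∷ t ∷ u ∷ []) (xws-A _ _ _ dv ≢C) (stu-C _ _ _ dv)
        (proj₁ (proj₂ colours)))

module _ {n} (χ : Colouring n ℕ) (free : RainbowFree χ) (7≤n : 7 ≤ n) {C : ℕ} {x′ y′ z′ w′ : Fin n}
  (D : Dominant χ C x′ y′ z′ w′) where

  open Dominant D
  open Facts χ free D

  private
    A≢B : A ≢ B
    A≢B = proj₁ colours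
    A≢C : A ≢ C
    A≢C = proj₁ (proj₂ colours)
    B≢C : B ≢ C
    B≢C = proj₂ (proj₂ colours)

    yzs≡B : ∀ {s′} → Fresh s′ (y′ ∷ x′ ∷ w′ ∷ z′ ∷ []) → χ (toSet (y′ , z′ , s′)) ≢ C →
      χ (toSet (y′ , z′ , s′)) ≡ B
    yzs≡B fr ≢C = trans (Facts.exposed-A χ free (dominant-swapXY (dominant-swapZW D)) 7≤n fr ≢C)
      (cong χ (toSet-swapˡ y′ x′ w′))

  -- The exposed edges have colours A on xw and B on yz. If they share their outside vertex s, then
  -- yzs, swx, xtu is rainbow. If their outside vertices are distinct, s and t, then xws, sut, tyz
  -- is.
  not-both-exposed : Exposed χ C x′ y′ z′ w′ → ¬ Exposed χ C y′ x′ w′ z′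
  not-both-exposed (s₁ , fr₁ , xws≢C) (s₂ , fr₂ , yzs≢C) with s₂ ≟ s₁
  ... | yes refl with t′ , u′ , dv ← complete 7≤n quad-distinct fr₁ =
    [ A≢B ∘ sym ∘ trans (sym (pull _ _ _ dv (y , z , s) (yzs≡B fr₂ yzs≢C))) ,
      B≢C ∘ trans (sym (pull _ _ _ dv (y , z , s) (yzs≡B fr₂ yzs≢C))) ]′
      (L.end _ _ _ dv (y ∷ z ∷ s ∷ w ∷ x ∷ t ∷ u ∷ []) (xws-A _ _ _ dv xws≢C) (xtu-C _ _ _ dv) A≢C)
  ... | no s₂≢s₁ with u′ , dv ← complete₂ 7≤n quad-distinct fr₁ (fresh-swapXY (fresh-swapZW fr₂)) s₂≢s₁ =
    [ A≢C ∘ sym ∘ trans (sym (stu-C _ _ _ dv)) , B≢C ∘ sym ∘ trans (sym (stu-C _ _ _ dv)) ]′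
      (L.middle _ _ _ dv (x ∷ w ∷ s ∷ u ∷ t ∷ y ∷ z ∷ []) (xws-A _ _ _ dv xws≢C)
        (pull _ _ _ dv (y , z , t) (yzs≡B fr₂ yzs≢C)) A≢B)

-- Edges of the other colours

AvoidedBy : ∀ {n} → Fin n → Triple n → Set
AvoidedBy v (a , b , d) = a ≢ v × b ≢ v × d ≢ v

StarShaped Displaceable : ∀ {n} → Colouring n ℕ → ℕ → Set
StarShaped {n} χ C = ∃ λ (v : Fin n) → ∀ τ → DistinctTriple τ → AvoidedBy v τ → χ (toSet τ) ≡ C
Displaceable {n} χ C = ∃ λ (π : Fin n → Fin n) → Injective _≡_ _≡_ π ×
  (∀ τ → DistinctTriple τ → χ (toSet τ) ≢ C → χ (toSet (mapTriple π τ)) ≡ C)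

module _ {n} (χ : Colouring n ℕ) (free : RainbowFree χ) (7≤n : 7 ≤ n) {C : ℕ} {x′ y′ z′ w′ : Fin n}
  (D : Dominant χ C x′ y′ z′ w′) where

  open Dominant D

  private
    q : Vec (Fin n) 4
    q = x′ ∷ y′ ∷ z′ ∷ w′ ∷ []

    Dy = dominant-swapXY D
    Dw = dominant-swapZW D

    module FX = Facts χ free D
    module FY = Facts χ free Dy
    module FW = Facts χ free Dw

    module _ {s′ t′ u′ : Fin n} (dv : Distinct (s′ ∷ t′ ∷ u′ ∷ q)) where

      dvY : Distinct (s′ ∷ t′ ∷ u′ ∷ y′ ∷ x′ ∷ z′ ∷ w′ ∷ [])
      dvY = permute-distinct (s′ ∷ t′ ∷ u′ ∷ q) (s ∷ t ∷ u ∷ y ∷ x ∷ z ∷ w ∷ []) dv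

      dvW : Distinct (s′ ∷ t′ ∷ u′ ∷ x′ ∷ y′ ∷ w′ ∷ z′ ∷ [])
      dvW = permute-distinct (s′ ∷ t′ ∷ u′ ∷ q) (s ∷ t ∷ u ∷ x ∷ y ∷ w ∷ z ∷ []) dv

      xtu-C : χ (toSet (x′ , t′ , u′)) ≡ C
      xtu-C = FX.push _ _ _ dv (x , t , u) (FX.xtu-C _ _ _ dv)
      ytu-C : χ (toSet (y′ , t′ , u′)) ≡ C
      ytu-C = FY.push _ _ _ dvY (x , t , u) (FY.xtu-C _ _ _ dvY)
      ztu-C : χ (toSet (z′ , t′ , u′)) ≡ C
      ztu-C = FX.push _ _ _ dv (z , t , u) (FX.ztu-C _ _ _ dv)
      wtu-C : χ (toSet (w′ , t′ , u′)) ≡ C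
      wtu-C = FW.push _ _ _ dvW (z , t , u) (FW.ztu-C _ _ _ dvW)
      zws-C : χ (toSet (z′ , w′ , s′)) ≡ C
      zws-C = FX.push _ _ _ dv (z , w , s) (FX.zws-C _ _ _ dv)

    first-fresh : ∀ {s′ t′ u′} → Distinct (s′ ∷ t′ ∷ u′ ∷ q) → Fresh s′ q
    first-fresh dv j = head-fresh dv (suc (suc j))

    unexposed : ∀ {a b d e s′} → ¬ Exposed χ C a b d e → Fresh s′ (a ∷ b ∷ d ∷ e ∷ []) →
      χ (toSet (a , e , s′)) ≡ C
    unexposed {a} {e = e} {s′} ne fr with χ (toSet (a , e , s′)) ℕ.≟ C
    ... | yes eq = eq
    ... | no ≢C = contradiction (s′ , fr , ≢C) ne

  -- The centre is `x′`. The pairs yz and yw are opposite to exposed pairs, hence unexposed, and yzw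
  -- lies in {A, C} because of xw and in {B, C} because of xz. Every other edge missing `x′` was
  -- already forced to have colour C.
  star : Exposed χ C x′ y′ z′ w′ → Exposed χ C x′ y′ w′ z′ → StarShaped χ C
  star xw xz = x′ , λ τ dτ av → lemma τ dτ av (covered 7≤n q quad-distinct τ dτ)
    where
    yw : ¬ Exposed χ C y′ x′ z′ w′
    yw = not-both-exposed χ free 7≤n Dw xz
    yz : ¬ Exposed χ C y′ x′ w′ z′
    yz = not-both-exposed χ free 7≤n D xw

    yzw-C : χ (toSet (y′ , z′ , w′)) ≡ C
    yzw-C = squeeze (proj₁ colours) (FX.yzw-AC 7≤n xw)
      (subst (λ p → p ≡ FX.B ⊎ p ≡ C) (cong χ (toSet-swapʳ y′ w′ z′)) (FW.yzw-AC 7≤n xz))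

    through : ∀ {τ i j} → AvoidedBy x′ τ → toSet τ ≢ toSet (x′ , i , j)
    through (a , b , d) e = [ a ∘ sym , [ b ∘ sym , d ∘ sym ]′ ]′ (toSet-injects e)

    lemma : ∀ τ → DistinctTriple τ → AvoidedBy x′ τ → Cover q τ → χ (toSet τ) ≡ C
    lemma τ dτ av (cover dv pos eq) with pos
    ... | stu = trans (cong χ eq) (outside-≡ _ _ _ dv)
    ... | xtu = contradiction eq (through av)
    ... | ytu = trans (cong χ eq) (ytu-C dv)
    ... | ztu = trans (cong χ eq) (ztu-C dv)
    ... | wtu = trans (cong χ eq) (wtu-C dv)
    ... | xys = contradiction eq (through av)
    ... | xzs = contradiction eq (through av)
    ... | xws = contradiction eq (through av)
    ... | yzs = trans (cong χ eq) (unexposed yz (fresh-swapXY (fresh-swapZW (first-fresh dv))))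
    ... | yws = trans (cong χ eq) (unexposed yw (fresh-swapXY (first-fresh dv)))
    ... | zws = trans (cong χ eq) (zws-C dv)
    ... | xyz = contradiction eq (through av)
    ... | xyw = contradiction eq (through av)
    ... | xzw = contradiction eq (through av)
    ... | yzw = trans (cong χ eq) yzw-C

  -- All edges of colour other than C meet T = {x′, y′, z′} twice, so an injection moving T off itself
  -- sends them to edges meeting T at most once.
  displaceable : ¬ Exposed χ C x′ y′ z′ w′ → ¬ Exposed χ C y′ x′ z′ w′ → Displaceable χ C
  displaceable xw yw = go outer
    where
    outer : ∃ λ s₀ → ∃ λ t₀ → ∃ λ u₀ → Distinct (s₀ ∷ t₀ ∷ u₀ ∷ q)
    outer with s₀ , fr ← fresh-exists q (ℕ.≤-trans (ℕ.m≤m+n 5 2) 7≤n) =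
      s₀ , complete 7≤n quad-distinct fr

    T : Fin n → Set
    T i = i ≡ x′ ⊎ i ≡ y′ ⊎ i ≡ z′

    x≢y : x′ ≢ y′
    x≢y e = head-fresh quad-distinct 0F (sym e)
    x≢z : x′ ≢ z′
    x≢z e = head-fresh quad-distinct 1F (sym e)
    y≢z : y′ ≢ z′
    y≢z e = head-fresh (tail-distinct quad-distinct) 0F (sym e)

    Tx : T x′
    Tx = inj₁ refl
    Ty : T y′
    Ty = inj₂ (inj₁ refl)
    Tz : T z′
    Tz = inj₂ (inj₂ refl)

    meets-twice : ∀ τ → Cover q τ → χ (toSet τ) ≢ C → TwoOf T τ
    meets-twice τ (cover dv pos eq) ≢C with pos
    ... | stu = contradiction (trans (cong χ eq) (outside-≡ _ _ _ dv)) ≢C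
    ... | xtu = contradiction (trans (cong χ eq) (xtu-C dv)) ≢C
    ... | ytu = contradiction (trans (cong χ eq) (ytu-C dv)) ≢C
    ... | ztu = contradiction (trans (cong χ eq) (ztu-C dv)) ≢C
    ... | wtu = contradiction (trans (cong χ eq) (wtu-C dv)) ≢C
    ... | xys = twoOf T eq x≢y Tx Ty
    ... | xzs = twoOf T eq x≢z Tx Tz
    ... | xws = contradiction (trans (cong χ eq) (unexposed xw (first-fresh dv))) ≢C
    ... | yzs = twoOf T eq y≢z Ty Tz
    ... | yws = contradiction (trans (cong χ eq) (unexposed yw (fresh-swapXY (first-fresh dv)))) ≢C
    ... | zws = contradiction (trans (cong χ eq) (zws-C dv)) ≢C
    ... | xyz = twoOf T eq x≢y Tx Ty
    ... | xyw = twoOf T eq x≢y Tx Ty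
    ... | xzw = twoOf T eq x≢z Tx Tz
    ... | yzw = twoOf T eq y≢z Ty Tz

    go : (∃ λ s₀ → ∃ λ t₀ → ∃ λ u₀ → Distinct (s₀ ∷ t₀ ∷ u₀ ∷ q)) → Displaceable χ C
    go (s₀ , t₀ , u₀ , dv) = along , along-injective involutive , moved
      where
      v = s₀ ∷ t₀ ∷ u₀ ∷ q

      -- Transposes s with x, t with y and u with z, fixing w, so T goes to three vertices outside
      -- Q.
      exchange : Vec (Fin 7) 7
      exchange = x ∷ y ∷ z ∷ s ∷ t ∷ u ∷ w ∷ []

      open Along v dv (lookup exchange)

      involutive : ∀ j → lookup exchange (lookup exchange j) ≡ j
      involutive = from-yes (all? λ j → lookup exchange (lookup exchange j) ≟ j)

      avoids-T : ∀ j {k} → along (lookup v k) ≡ lookup v j → j ≢ x → j ≢ y → j ≢ z →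
        ¬ T (along (lookup v k))
      avoids-T j e j≢x j≢y j≢z =
        [ j≢x ∘ dv j x ∘ trans (sym e) , [ j≢y ∘ dv j y ∘ trans (sym e) , j≢z ∘ dv j z ∘ trans (sym e) ]′ ]′

      off-T : ∀ i → T i → ¬ T (along i)
      off-T _ (inj₁ refl)        = avoids-T s {x} (along-lookup x) (λ ()) (λ ()) (λ ())
      off-T _ (inj₂ (inj₁ refl)) = avoids-T t {y} (along-lookup y) (λ ()) (λ ()) (λ ())
      off-T _ (inj₂ (inj₂ refl)) = avoids-T u {z} (along-lookup z) (λ ()) (λ ()) (λ ())

      moved : ∀ τ → DistinctTriple τ → χ (toSet τ) ≢ C → χ (toSet (mapTriple along τ)) ≡ C
      moved τ@(_ , _ , _) dτ@(a≢b , b≢d , a≢d) ≢C with χ (toSet (mapTriple along τ)) ℕ.≟ C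
      ... | yes eq = eq
      -- Otherwise the edge and its image both meet T in two positions. At a common position a
      -- vertex of T would be sent into T.
      ... | no ≢C′ = contradiction
        (meets-twice _ (covered 7≤n q quad-distinct (mapTriple along τ)
          (a≢b ∘ along-injective involutive , b≢d ∘ along-injective involutive ,
           a≢d ∘ along-injective involutive)) ≢C′)
        (twoOf-clash off-T (meets-twice τ (covered 7≤n q quad-distinct τ dτ) ≢C))

-- View xw, wy, yz, zx as a 4-cycle. Opposite sides are never both exposed, so at most two sides
-- are, and two exposed sides share a vertex. If that vertex is x or y, it is the centre of a star.
-- In every remaining case w or z lies on no exposed side, and the other three vertices of Q form T.
dominant-structure : ∀ {n} (χ : Colouring n ℕ) → RainbowFree χ → 7 ≤ n → ∀ {C x′ y′ z′ w′} →
  Dominant χ C x′ y′ z′ w′ → StarShaped χ C ⊎ Displaceable χ C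
dominant-structure χ free 7≤n {C} {x′} {y′} {z′} {w′} D
  with exposed? χ C x′ y′ z′ w′ | exposed? χ C y′ x′ z′ w′
     | exposed? χ C x′ y′ w′ z′ | exposed? χ C y′ x′ w′ z′
... | yes xw | _      | yes xz | _      = inj₁ (star χ free 7≤n D xw xz)
... | _      | yes yw | _      | yes yz = inj₁ (star χ free 7≤n (dominant-swapXY D) yw yz)
... | no ¬xw | no ¬yw | _      | _      = inj₂ (displaceable χ free 7≤n D ¬xw ¬yw)
... | _      | _      | no ¬xz | no ¬yz = inj₂ (displaceable χ free 7≤n (dominant-swapZW D) ¬xz ¬yz)
... | yes xw | no _   | no _   | yes yz = contradiction yz (not-both-exposed χ free 7≤n D xw)
... | no _   | yes yw | yes xz | no _   = contradiction xz (not-both-exposed χ free 7≤n (dominant-swapXY D) yw)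

-- Embedding H

anyTriple? : ∀ {n} {P : Triple n → Set} → (∀ τ → Dec (P τ)) → Dec (∃ P)
anyTriple? P? = map′ (λ (a , b , d , p) → (a , b , d) , p) (λ ((a , b , d) , p) → a , b , d , p)
  (any? λ a → any? λ b → any? λ d → P? (a , b , d))

data Palette {n} (χ : Colouring n ℕ) : Set where
  two-colours : ∀ p q → (∀ τ → DistinctTriple τ → χ (toSet τ) ≢ p → χ (toSet τ) ≡ q) → Palette χ
  three-colours : ∀ σ τ υ → DistinctTriple σ → DistinctTriple τ → DistinctTriple υ →
    χ (toSet σ) ≢ χ (toSet τ) → χ (toSet σ) ≢ χ (toSet υ) → χ (toSet τ) ≢ χ (toSet υ) → Palette χ

palette : ∀ {n} (χ : Colouring n ℕ) → Palette χ
palette χ with anyTriple? distinctTriple?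
-- There are no edges at all, so both colours are placeholders.
... | no none = two-colours 0 0 λ τ dτ → contradiction (τ , dτ) none
... | yes (σ , dσ) with anyTriple? (λ τ → distinctTriple? τ ×-dec ¬? (χ (toSet σ) ℕ.≟ χ (toSet τ)))
-- Only one colour occurs; the second is a placeholder.
... | no none = two-colours (χ (toSet σ)) 0 λ τ dτ ≢p → contradiction (τ , dτ , ≢p ∘ sym) none
... | yes (τ , dτ , σ≢τ)
  with anyTriple? (λ υ → distinctTriple? υ ×-dec
         ¬? (χ (toSet σ) ℕ.≟ χ (toSet υ)) ×-dec ¬? (χ (toSet τ) ℕ.≟ χ (toSet υ)))
... | yes (υ , dυ , σ≢υ , τ≢υ) = three-colours σ τ υ dσ dτ dυ σ≢τ σ≢υ τ≢υ
... | no none = two-colours (χ (toSet σ)) (χ (toSet τ)) λ υ dυ ≢p → remaining υ dυ ≢p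
  where
  remaining : ∀ υ → DistinctTriple υ → χ (toSet υ) ≢ χ (toSet σ) → χ (toSet υ) ≡ χ (toSet τ)
  remaining υ dυ ≢p with χ (toSet τ) ℕ.≟ χ (toSet υ)
  ... | yes e = sym e
  ... | no τ≢υ = contradiction (υ , dυ , ≢p ∘ sym , τ≢υ) none

image-edge-distinct : ∀ {n} (H : Hyp3) (φ : Fin (k H) → Fin n) → Injective _≡_ _≡_ φ → ∀ i →
  DistinctTriple (mapTriple φ (edge H i))
image-edge-distinct H φ φ-inj i with a≢b , b≢d , a≢d ← distinct H i =
  a≢b ∘ φ-inj , b≢d ∘ φ-inj , a≢d ∘ φ-inj

constant-mono : ∀ {n} (H : Hyp3) (χ : Colouring n ℕ) φ → Injective _≡_ _≡_ φ → ∀ p →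
  (∀ i → colourOf H χ φ i ≡ p) → HasMono H χ
constant-mono H χ φ φ-inj p ≡p = φ , φ-inj , λ i j → trans (≡p i) (sym (≡p j))

does-true : ∀ {P : Set} (P? : Dec P) → does P? ≡ true → P
does-true (yes p) _ = p

-- All colours other than `p` are merged into one, and the two-colour hypothesis is applied to the
-- result.
arrows₂-split : ∀ {n} (H : Hyp3) → Arrows2 H n → (χ : Colouring n ℕ) → ∀ p →
  ∃ λ φ → Injective _≡_ _≡_ φ × ((∀ i → colourOf H χ φ i ≡ p) ⊎ (∀ i → colourOf H χ φ i ≢ p))
arrows₂-split H arrows χ p with φ , φ-inj , mono ← arrows (λ S → does (χ S ℕ.≟ p))
  with any? (λ i → colourOf H χ φ i ℕ.≟ p)
... | no none = φ , φ-inj , inj₂ λ i e → none (i , e)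
... | yes (i , e) = φ , φ-inj , inj₁ λ j →
  does-true (colourOf H χ φ j ℕ.≟ p) (trans (mono j i) (dec-true (colourOf H χ φ i ℕ.≟ p) e))

star-mono : ∀ {n} (H : Hyp3) (χ : Colouring n ℕ) {C} → k H < n → StarShaped χ C → HasMono H χ
star-mono {suc n} H χ {C} k<n (v , ≡C) = constant-mono H χ φ φ-inj C λ i →
  ≡C _ (image-edge-distinct H φ φ-inj i) (punchInᵢ≢i v _ , punchInᵢ≢i v _ , punchInᵢ≢i v _)
  where
  φ : Fin (k H) → Fin (suc n)
  -- After `v` is deleted, `k H < n` still leaves room for all vertices of `H`.
  φ = punchIn v ∘ λ i → inject≤ i (ℕ.≤-pred k<n)
  φ-inj : Injective _≡_ _≡_ φ
  φ-inj {i} {j} e = inject≤-injective _ _ i j (punchIn-injective v _ _ e)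

displaceable-mono : ∀ {n} (H : Hyp3) (χ : Colouring n ℕ) {C} → Arrows2 H n →
  Displaceable χ C → HasMono H χ
displaceable-mono H χ {C} arrows (π , π-inj , moved) with arrows₂-split H arrows χ C
... | φ , φ-inj , inj₁ ≡C = constant-mono H χ φ φ-inj C ≡C
... | φ , φ-inj , inj₂ ≢C = constant-mono H χ (π ∘ φ) (φ-inj ∘ π-inj) C λ i →
  moved _ (image-edge-distinct H φ φ-inj i) (≢C i)

rainbowFree-mono : ∀ {n} (H : Hyp3) (χ : Colouring n ℕ) → Arrows2 H n → k H < n → 7 ≤ n →
  RainbowFree χ → HasMono H χ
rainbowFree-mono H χ arrows k<n 7≤n free with palette χ
... | two-colours p q ≢p⇒≡q with arrows₂-split H arrows χ p
...   | φ , φ-inj , inj₁ ≡p = constant-mono H χ φ φ-inj p ≡p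
...   | φ , φ-inj , inj₂ ≢p = constant-mono H χ φ φ-inj q λ i →
  ≢p⇒≡q _ (image-edge-distinct H φ φ-inj i) (≢p i)
rainbowFree-mono H χ arrows k<n 7≤n free | three-colours σ τ υ dσ dτ dυ σ≢τ σ≢υ τ≢υ
  with C , _ , _ , _ , _ , D ← dominant-exists χ free (hasBase χ free 7≤n σ τ υ dσ dτ dυ σ≢τ σ≢υ τ≢υ)
  = [ star-mono H χ k<n , displaceable-mono H χ arrows ]′ (dominant-structure χ free 7≤n D)

-- Deciding rainbow copies, and the two bounds

anyVec? : ∀ {n} m {P : Vec (Fin n) m → Set} → (∀ v → Dec (P v)) → Dec (∃ P)
anyVec? 0       P? = map′ (λ p → [] , p) (λ { ([] , p) → p }) (P? [])
anyVec? (suc m) P? = map′ (λ (i , v , p) → i ∷ v , p) (λ { (i ∷ v , p) → i , v , p })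
  (any? λ i → anyVec? m λ v → P? (i ∷ v))

-- The upper bound must decide constructively which alternative holds. Embeddings are coded as
-- vectors so that they can be searched exhaustively.
rainbow? : ∀ {n} (χ : Colouring n ℕ) → Dec (HasRainbow LoosePath χ)
rainbow? {n} χ = map′ to from (anyVec? 7 λ v → distinct? v ×-dec
  all? λ i → all? λ j → (χ (link v i) ℕ.≟ χ (link v j)) →-dec (i ≟ j))
  where
  Rainbow : Vec (Fin n) 7 → Set
  Rainbow v = Distinct v × (∀ i j → χ (link v i) ≡ χ (link v j) → i ≡ j)

  to : ∃ Rainbow → HasRainbow LoosePath χ
  to (v , dv , rainbow) = lookup v , dv _ _ , rainbow

  from : HasRainbow LoosePath χ → ∃ Rainbow
  from (φ , φ-inj , rainbow) = tabulate φ ,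
    (λ i j e → φ-inj (trans (sym (lookup∘tabulate φ i)) (trans e (lookup∘tabulate φ j)))) ,
    (λ i j e → rainbow i j (trans (sym (same i)) (trans e (same j))))
    where
    same : ∀ i → χ (link (tabulate φ) i) ≡ colourOf LoosePath χ φ i
    same i = cong (χ ∘ toSet) (cong₂ _,_ (lookup∘tabulate φ _)
      (cong₂ _,_ (lookup∘tabulate φ _) (lookup∘tabulate φ _)))

agreement : ∀ (a b c : Bool) → a ≡ b ⊎ a ≡ c ⊎ b ≡ c
agreement false false _     = inj₁ refl
agreement true  true  _     = inj₁ refl
agreement false true  false = inj₂ (inj₁ refl)
agreement true  false true  = inj₂ (inj₁ refl)
agreement false true  true  = inj₂ (inj₂ refl)
agreement true  false false = inj₂ (inj₂ refl)

theorem1p10 : (H : Hyp3) (r : ℕ) → IsR2 H r → r ≥ suc (k H) ⊔ 7 →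
    IsConstrainedRamsey H LoosePath r
theorem1p10 H r (arrows , minimal) r≥ = upper , λ n n<r cr → minimal n n<r (lower n cr)
  where
  upper : ArrowsCR H LoosePath r
  upper χ with rainbow? χ
  ... | yes rainbow = inj₂ rainbow
  ... | no free = inj₁ (rainbowFree-mono H χ arrows
          (ℕ.m⊔n≤o⇒m≤o _ 7 r≥) (ℕ.m⊔n≤o⇒n≤o (suc (k H)) 7 r≥) free)

  code : Bool → ℕ
  code true  = 1
  code false = 0

  code-injective : ∀ {a b} → code a ≡ code b → a ≡ b
  code-injective {true}  {true}  _ = refl
  code-injective {false} {false} _ = refl

  -- A 2-colouring read with the colours 0 and 1 cannot give three edges three different colours, so
  -- the first alternative must hold.
  lower : ∀ n → ArrowsCR H LoosePath n → Arrows2 H n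
  lower n cr χ with cr (code ∘ χ)
  ... | inj₁ (φ , φ-inj , mono) = φ , φ-inj , λ i j → code-injective (mono i j)
  ... | inj₂ (φ , _ , rainbow)
    with agreement (colourOf LoosePath χ φ 0F) (colourOf LoosePath χ φ 1F) (colourOf LoosePath χ φ 2F)
  ...   | inj₁ e        with () ← rainbow 0F 1F (cong code e)
  ...   | inj₂ (inj₁ e) with () ← rainbow 0F 2F (cong code e)
  ...   | inj₂ (inj₂ e) with () ← rainbow 1F 2F (cong code e)
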